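{- The class of $(\overline{2P_1+P_2},\,P_2+P_4,\,P_6)$-free graphs is not well-quasi-ordered by the induced subgraph relation.
   Context: Graphs are finite, undirected and simple. $P_r$ is the path on $r$ vertices, $G+H$ is the disjoint union of vertex-disjoint graphs $G,H$, $rG$ is the disjoint union of $r$ copies of $G$, and $\overline{G}$ is the complement of $G$. A graph is $(H_1,\ldots,H_p)$-free if it has no induced subgraph isomorphic to any of $H_1,\ldots,H_p$. The induced subgraph relation is the quasi-order in which $H\leq G$ if and only if $H$ is isomorphic to an induced subgraph of $G$. A quasi-order $\leq$ on a set (or class) $X$ is a well-quasi-order if every infinite sequence $x_1,x_2,\ldots$ in $X$ contains a pair with $x_i\leq x_j$, $i<j$ (equivalently: no infinite strictly decreasing sequence and no infinite antichain). -}

module Defs where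

open import Data.Fin.Base using (Fin; zero; suc; toℕ; splitAt)
open import Data.Fin.Properties using (_≟_; any?; suc-injective)
open import Data.Fin.Subset using (Subset; inside; outside; ∣_∣; _∈_)
open import Data.List.Base using (List)
open import Data.List.Relation.Unary.All using (All)
open import Data.Nat.Base as ℕ using (ℕ; zero; suc; _+_; _<_)
import Data.Nat.Properties as ℕ
open import Data.Product.Base using (Σ; ∃; ∃₂; _×_; _,_; proj₁; proj₂)
open import Data.Sum.Base using (_⊎_; inj₁; inj₂; swap)
open import Data.Vec.Base using (_∷_; tabulate; here; there)
open import Data.Vec.Properties using (lookup∘tabulate; lookup⇒[]=; []=⇒lookup)
open import Data.Empty using () renaming (⊥ to Empty)
open import Function.Base using (_∘_; id)
open import Function.Bundles using (_↔_; _⇔_; mk⇔; mk↔ₛ′; Injection; Inverse; Equivalence)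
open import Function.Definitions using (Injective)
open import Function.Properties.Inverse using (↔⇒↣)
open import Level using (0ℓ; _⊔_) renaming (suc to ℓsuc)
open import Relation.Binary.Bundles using (Preorder)
import Relation.Binary.Construct.On as On
open import Relation.Binary.Core using (Rel)
open import Relation.Binary.Definitions
  using (Decidable; Symmetric; Irreflexive; Reflexive; Transitive)
open import Relation.Binary.PropositionalEquality
  using (_≡_; _≢_; refl; sym; trans; cong; subst₂; isEquivalence)
open import Relation.Nullary.Decidable
  using (Dec; yes; no; does; ¬?; _×-dec_; _⊎-dec_; dec-true)
open import Relation.Nullary.Negation using (¬_)
open import Relation.Unary using (Pred)

record Graph : Set₁ where
  field
    order  : ℕ
    Adj    : Rel (Fin order) 0ℓ
    adj?   : Decidable Adj
    symm   : Symmetric Adj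
    irrefl : Irreflexive _≡_ Adj

open Graph public

complement : Graph → Graph
complement G = record
  { order  = order G
  ; Adj    = λ u v → u ≢ v × ¬ Adj G u v
  ; adj?   = λ u v → ¬? (u ≟ v) ×-dec ¬? (adj? G u v)
  ; symm   = λ (u≢v , u≁v) → u≢v ∘ sym , u≁v ∘ symm G
  ; irrefl = λ u≡v (u≢v , _) → u≢v u≡v
  }

module _ (G H : Graph) where

  UnionAdj : Rel (Fin (order G) ⊎ Fin (order H)) 0ℓ
  UnionAdj (inj₁ u) (inj₁ v) = Adj G u v
  UnionAdj (inj₁ _) (inj₂ _) = Empty
  UnionAdj (inj₂ _) (inj₁ _) = Empty
  UnionAdj (inj₂ u) (inj₂ v) = Adj H u v

  unionAdj? : Decidable UnionAdj
  unionAdj? (inj₁ u) (inj₁ v) = adj? G u v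
  unionAdj? (inj₁ _) (inj₂ _) = no λ ()
  unionAdj? (inj₂ _) (inj₁ _) = no λ ()
  unionAdj? (inj₂ u) (inj₂ v) = adj? H u v

  unionSymm : Symmetric UnionAdj
  unionSymm {inj₁ _} {inj₁ _} = symm G
  unionSymm {inj₂ _} {inj₂ _} = symm H

  unionIrrefl : Irreflexive _≡_ UnionAdj
  unionIrrefl {inj₁ _} refl = irrefl G refl
  unionIrrefl {inj₂ _} refl = irrefl H refl

infixr 6 _⊕_
infixr 7 _·_

_⊕_ : Graph → Graph → Graph
G ⊕ H = record
  { order  = order G + order H
  ; Adj    = λ u v → UnionAdj G H (split u) (split v)
  ; adj?   = λ u v → unionAdj? G H (split u) (split v)
  ; symm   = λ {u} {v} → unionSymm G H {split u} {split v}
  ; irrefl = λ u≡v → unionIrrefl G H (cong split u≡v)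
  }
  where
  split : Fin (order G + order H) → Fin (order G) ⊎ Fin (order H)
  split = splitAt (order G)

P : ℕ → Graph
P r = record
  { order  = r
  ; Adj    = λ u v → suc (toℕ u) ≡ toℕ v ⊎ suc (toℕ v) ≡ toℕ u
  ; adj?   = λ u v → (suc (toℕ u) ℕ.≟ toℕ v) ⊎-dec (suc (toℕ v) ℕ.≟ toℕ u)
  ; symm   = swap
  ; irrefl = λ { refl (inj₁ e) → ℕ.1+n≢n e ; refl (inj₂ e) → ℕ.1+n≢n e }
  }

_·_ : ℕ → Graph → Graph
zero  · G = P 0
suc r · G = G ⊕ r · G

infix 4 _≅_ _⊑_

_≅_ : Graph → Graph → Set
G ≅ H = Σ (Fin (order G) ↔ Fin (order H)) λ φ →
  ∀ u v → Adj G u v ⇔ Adj H (Inverse.to φ u) (Inverse.to φ v)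

-- The increasing enumeration of the elements of S; it makes Fin ∣ S ∣ the
-- vertex set of the subgraph induced by S.
enum : ∀ {n} (S : Subset n) → Fin ∣ S ∣ → Fin n
enum (inside  ∷ S) zero    = zero
enum (inside  ∷ S) (suc i) = suc (enum S i)
enum (outside ∷ S) i       = suc (enum S i)

_[_] : (G : Graph) → Subset (order G) → Graph
G [ S ] = record
  { order  = ∣ S ∣
  ; Adj    = λ i j → Adj G (enum S i) (enum S j)
  ; adj?   = λ i j → adj? G (enum S i) (enum S j)
  ; symm   = symm G
  ; irrefl = λ i≡j → irrefl G (cong (enum S) i≡j)
  }

_⊑_ : Graph → Graph → Set
H ⊑ G = ∃ λ (S : Subset (order G)) → H ≅ G [ S ]

enum-injective : ∀ {n} (S : Subset n) → Injective _≡_ _≡_ (enum S)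
enum-injective (inside  ∷ S) {zero}  {zero}  _  = refl
enum-injective (inside  ∷ S) {suc i} {suc j} eq =
  cong suc (enum-injective S (suc-injective eq))
enum-injective (outside ∷ S) eq = enum-injective S (suc-injective eq)

enum-∈ : ∀ {n} (S : Subset n) i → enum S i ∈ S
enum-∈ (inside  ∷ S) zero    = here
enum-∈ (inside  ∷ S) (suc i) = there (enum-∈ S i)
enum-∈ (outside ∷ S) i       = there (enum-∈ S i)

enum-surjective : ∀ {n} (S : Subset n) {x} → x ∈ S → ∃ λ i → enum S i ≡ x
enum-surjective (inside  ∷ S) here      = zero , refl
enum-surjective (inside  ∷ S) (there p) with enum-surjective S p
... | i , eq = suc i , cong suc eq
enum-surjective (outside ∷ S) (there p) with enum-surjective S p
... | i , eq = i , cong suc eq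

Embedding : Graph → Graph → Set
Embedding H G = Σ (Fin (order H) → Fin (order G)) λ f →
  Injective _≡_ _≡_ f × (∀ u v → Adj H u v ⇔ Adj G (f u) (f v))

⊑⇒embedding : ∀ H G → H ⊑ G → Embedding H G
⊑⇒embedding H G (S , φ , φ-adj) =
  enum S ∘ Inverse.to φ , Injection.injective (↔⇒↣ φ) ∘ enum-injective S , φ-adj

embedding⇒⊑ : ∀ H G → Embedding H G → H ⊑ G
embedding⇒⊑ H G (f , f-inj , f-adj) =
  S , mk↔ₛ′ to from to∘from from∘to , adj
  where
  inImage? : ∀ x → Dec (∃ λ u → f u ≡ x)
  inImage? x = any? λ u → f u ≟ x

  S : Subset (order G)
  S = tabulate (does ∘ inImage?)

  f∈S : ∀ u → f u ∈ S
  f∈S u = lookup⇒[]= (f u) S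
    (trans (lookup∘tabulate (does ∘ inImage?) (f u))
           (dec-true (inImage? (f u)) (u , refl)))

  preimage : ∀ {x} → x ∈ S → ∃ λ u → f u ≡ x
  preimage {x} x∈S
    with inImage? x
       | trans (sym (lookup∘tabulate (does ∘ inImage?) x)) ([]=⇒lookup x∈S)
  ... | yes p | _ = p

  to : Fin (order H) → Fin ∣ S ∣
  to u = proj₁ (enum-surjective S (f∈S u))

  enum-to : ∀ u → enum S (to u) ≡ f u
  enum-to u = proj₂ (enum-surjective S (f∈S u))

  from : Fin ∣ S ∣ → Fin (order H)
  from i = proj₁ (preimage (enum-∈ S i))

  f-from : ∀ i → f (from i) ≡ enum S i
  f-from i = proj₂ (preimage (enum-∈ S i))

  to∘from : ∀ i → to (from i) ≡ i
  to∘from i = enum-injective S (trans (enum-to (from i)) (f-from i))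

  from∘to : ∀ u → from (to u) ≡ u
  from∘to u = f-inj (trans (f-from (to u)) (enum-to u))

  adj : ∀ u v → Adj H u v ⇔ Adj G (enum S (to u)) (enum S (to v))
  adj u v = subst₂ (λ x y → Adj H u v ⇔ Adj G x y)
    (sym (enum-to u)) (sym (enum-to v)) (f-adj u v)

⊑-refl : Reflexive _⊑_
⊑-refl {G} = embedding⇒⊑ G G (id , id , λ _ _ → mk⇔ id id)

⊑-trans : Transitive _⊑_
⊑-trans {H} {G} {K} H⊑G G⊑K with ⊑⇒embedding H G H⊑G | ⊑⇒embedding G K G⊑K
... | f , f-inj , f-adj | g , g-inj , g-adj = embedding⇒⊑ H K
  ( g ∘ f
  , f-inj ∘ g-inj
  , λ u v → mk⇔
      (Equivalence.to (g-adj (f u) (f v)) ∘ Equivalence.to (f-adj u v))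
      (Equivalence.from (f-adj u v) ∘ Equivalence.from (g-adj (f u) (f v)))
  )

-- The underlying equality of the bundle is immaterial: only _≲_ enters
-- WellQuasiOrder.
⊑-preorder : Preorder (ℓsuc 0ℓ) (ℓsuc 0ℓ) 0ℓ
⊑-preorder = record
  { Carrier    = Graph
  ; _≈_        = _≡_
  ; _≲_        = _⊑_
  ; isPreorder = record
    { isEquivalence = isEquivalence
    ; reflexive     = λ { {G} refl → ⊑-refl {G} }
    ; trans         = λ {H} {G} {K} → ⊑-trans {H} {G} {K}
    }
  }

WellQuasiOrder : ∀ {c ℓ₁ ℓ₂} → Preorder c ℓ₁ ℓ₂ → Set (c ⊔ ℓ₂)
WellQuasiOrder Q = ∀ (x : ℕ → Carrier) → ∃₂ λ i j → i < j × x i ≲ x j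
  where open Preorder Q

inducedSubgraphOrder : ∀ {ℓ} → Pred Graph ℓ → Preorder (ℓsuc 0ℓ ⊔ ℓ) (ℓsuc 0ℓ) 0ℓ
inducedSubgraphOrder C = On.preorder ⊑-preorder (proj₁ {B = C})

_-free : List Graph → Pred Graph (ℓsuc 0ℓ)
(Hs -free) G = All (λ H → ¬ H ⊑ G) Hs

{-# OPTIONS --safe #-}

-- Take a cycle of length 8(m + 1) whose vertices are cyclically of the kinds
-- left, apex, right, apex, and join every left vertex to every right vertex:
-- a complete bipartite graph with a triangle glued to each edge of a
-- Hamiltonian cycle. The forbidden graphs are excluded because an apex has
-- exactly one neighbour on each side, while any path on four vertices meets
-- both sides and so dominates all left and right vertices. An embedding of one
-- such graph into another must preserve the cycle edges, and a cycle does not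
-- embed into a longer one; the graphs therefore form an infinite antichain.

module Submission where

open import Defs
open import Data.Empty using (⊥)
open import Data.Fin.Base using (Fin; zero; suc; toℕ; fromℕ; inject₁; _↑ˡ_; _↑ʳ_)
open import Data.Fin.Induction using (<-weakInduction)
open import Data.Fin.Patterns
open import Data.Fin.Properties
  using (_≟_; all?; toℕ-fromℕ; toℕ-inject₁; injective⇒≤)
open import Data.Fin.Relation.Unary.Top
  using (view; ‵fromℕ; ‵inject₁; view-fromℕ; view-inject₁)
open import Data.List.Base using ([]; _∷_)
open import Data.List.Relation.Unary.All using ([]; _∷_)
open import Data.Nat.Base using (ℕ; zero; suc; _+_; _*_; _≤_; s<s)
open import Data.Nat.Properties using (<⇒≱; *-monoˡ-<)
open import Data.Product.Base using (∃; ∃₂; _×_; _,_; proj₁; proj₂)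
open import Data.Sum.Base using (_⊎_; inj₁; inj₂; [_,_]′; swap)
open import Function.Base using (_∘_; id)
open import Function.Bundles using (Equivalence)
open import Relation.Binary.PropositionalEquality
  using (_≡_; _≢_; refl; sym; trans; cong; subst; ≢-sym)
open import Relation.Nullary.Decidable
  using (Dec; yes; no; True; False; toWitness; toWitnessFalse; fromWitnessFalse;
         from-yes; ¬?; _⊎-dec_; _×-dec_)
open import Relation.Nullary.Negation using (¬_; contradiction)

private variable
  k : ℕ

-- Vertex kinds and the opposite-side relation.

data Kind : Set where
  apex left right : Kind

data Opposite : Kind → Kind → Set where
  lr : Opposite left right
  rl : Opposite right left

Core : Kind → Set
Core c = c ≢ apex

apex? : ∀ c → Dec (c ≡ apex)
apex? apex  = yes refl
apex? left  = no λ ()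
apex? right = no λ ()

opposite? : ∀ c d → Dec (Opposite c d)
opposite? apex  _     = no λ ()
opposite? left  apex  = no λ ()
opposite? left  left  = no λ ()
opposite? left  right = yes lr
opposite? right apex  = no λ ()
opposite? right left  = yes rl
opposite? right right = no λ ()

opposite-sym : ∀ {c d} → Opposite c d → Opposite d c
opposite-sym lr = rl
opposite-sym rl = lr

opposite-irrefl : ∀ {c} → ¬ Opposite c c
opposite-irrefl ()

opposite-bipartite : ∀ {c d e} → Opposite c d → Opposite d e → ¬ Opposite c e
opposite-bipartite lr rl ()
opposite-bipartite rl lr ()

opposite⇒core : ∀ {c d} → Opposite c d → Core c
opposite⇒core lr ()
opposite⇒core rl ()

-- Between them `d` and `e` occupy both sides, and `c` lies on one of the two.
opposite-either : ∀ {c d e} → Core c → Opposite d e → Opposite c d ⊎ Opposite c e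
opposite-either {apex}  core _ = contradiction refl core
opposite-either {left}  _ lr = inj₂ lr
opposite-either {left}  _ rl = inj₁ lr
opposite-either {right} _ lr = inj₁ rl
opposite-either {right} _ rl = inj₂ rl

same-side : ∀ {c d} → Core c → Core d → ¬ Opposite c d → c ≡ d
same-side {apex}  {_}     c _ _ = contradiction refl c
same-side {left}  {apex}  _ d _ = contradiction refl d
same-side {left}  {left}  _ _ _ = refl
same-side {left}  {right} _ _ o = contradiction lr o
same-side {right} {apex}  _ d _ = contradiction refl d
same-side {right} {left}  _ _ o = contradiction rl o
same-side {right} {right} _ _ _ = refl

-- Rims and the graphs built on them.

Alternating : Kind → Kind → Set
Alternating c d = c ≡ apex × Core d ⊎ Core c × d ≡ apex

-- In a rim of length 4, which next⁴-≢ excludes, both apices would have the same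
-- neighbours, giving a diamond.
record Rim : Set₁ where
  field
    length    : ℕ
    next prev : Fin length → Fin length
    next-prev : ∀ u → next (prev u) ≡ u
    prev-next : ∀ u → prev (next u) ≡ u
    next⁴-≢   : ∀ u → next (next (next (next u))) ≢ u
    connected : (Q : Fin length → Set) →
      (∀ u → Q u → Q (next u)) → (∀ u → Q u → Q (prev u)) →
      ∀ {u} → Q u → ∀ v → Q v
    kind        : Fin length → Kind
    alternating : ∀ u → Alternating (kind u) (kind (next u))
    core-next²  : ∀ u → Core (kind u) → Opposite (kind u) (kind (next (next u)))

module Garland (R : Rim) where
  open Rim R

  V : Set
  V = Fin length

  -- The rim edges, which are the only edges at an apex.
  Thin : V → V → Set
  Thin u v = next u ≡ v ⊎ next v ≡ u

  garland : Graph
  garland = record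
    { order  = length
    ; Adj    = λ u v → Thin u v ⊎ Opposite (kind u) (kind v)
    ; adj?   = λ u v → (next u ≟ v ⊎-dec next v ≟ u) ⊎-dec opposite? (kind u) (kind v)
    ; symm   = λ { (inj₁ t) → inj₁ (swap t) ; (inj₂ o) → inj₂ (opposite-sym o) }
    ; irrefl = λ { {u} refl → [ [ next-≢ u , next-≢ u ]′ , opposite-irrefl ]′ }
    }
    where
    next-≢ : (u : V) → next u ≢ u
    next-≢ u eq = next⁴-≢ u
      (trans (cong (next ∘ next ∘ next) eq) (trans (cong (next ∘ next) eq) (trans (cong next eq) eq)))

  infix 4 _~_
  _~_ : V → V → Set
  _~_ = Adj garland

  ~-sym : {u v : V} → u ~ v → v ~ u
  ~-sym {u} {v} = symm garland {u} {v}

  ~-next : (u : V) → u ~ next u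
  ~-next u = inj₁ (inj₁ refl)

  ~-prev : (u : V) → u ~ prev u
  ~-prev u = inj₁ (inj₂ (next-prev u))

  thin⇒alternating : {u v : V} → Thin u v → Alternating (kind u) (kind v)
  thin⇒alternating {u = u} (inj₁ refl) = alternating u
  thin⇒alternating {v = v} (inj₂ refl) with alternating v
  ... | inj₁ (a , c) = inj₂ (c , a)
  ... | inj₂ (c , a) = inj₁ (a , c)

  thin⇒neighbour : {u v : V} → Thin u v → v ≡ next u ⊎ v ≡ prev u
  thin⇒neighbour         (inj₁ eq)   = inj₁ (sym eq)
  thin⇒neighbour {v = v} (inj₂ refl) = inj₂ (sym (prev-next v))

  apex-thin : {u v : V} → kind u ≡ apex → u ~ v → Thin u v
  apex-thin a (inj₁ t) = t
  apex-thin a (inj₂ o) = contradiction a (opposite⇒core o)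

  core-opposite : {u v : V} → Core (kind u) → Core (kind v) → u ~ v →
                  Opposite (kind u) (kind v)
  core-opposite c d (inj₂ o) = o
  core-opposite c d (inj₁ t) with thin⇒alternating t
  ... | inj₁ (a , _) = contradiction a c
  ... | inj₂ (_ , a) = contradiction a d

  edge-meets-core : {u v : V} → u ~ v → Core (kind u) ⊎ Core (kind v)
  edge-meets-core (inj₂ o) = inj₁ (opposite⇒core o)
  edge-meets-core (inj₁ t) with thin⇒alternating t
  ... | inj₁ (_ , c) = inj₂ c
  ... | inj₂ (c , _) = inj₁ c

  core-next : ∀ {u} → Core (kind u) → kind (next u) ≡ apex
  core-next {u} c with alternating u
  ... | inj₁ (a , _) = contradiction a c
  ... | inj₂ (_ , a) = a

  core-prev : ∀ {u} → Core (kind u) → kind (prev u) ≡ apex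
  core-prev {u} c with thin⇒alternating {u = u} {prev u} (inj₂ (next-prev u))
  ... | inj₁ (a , _) = contradiction a c
  ... | inj₂ (_ , a) = a

  next≢prev : ∀ u → next u ≢ prev u
  next≢prev u eq = next⁴-≢ u (trans (cong (next ∘ next) next²≡) next²≡)
    where
    next²≡ : next (next u) ≡ u
    next²≡ = trans (cong next eq) (next-prev u)

  apex-prev : (u : V) → kind u ≡ apex → Core (kind (prev u))
  apex-prev u a with thin⇒alternating {u = u} {prev u} (inj₂ (next-prev u))
  ... | inj₁ (_ , c) = c
  ... | inj₂ (c , _) = contradiction a c

  apex-ends : (u : V) → kind u ≡ apex → Opposite (kind (prev u)) (kind (next u))
  apex-ends u a = subst (λ v → Opposite (kind (prev u)) (kind (next v))) (next-prev u)
    (core-next² (prev u) (apex-prev u a))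

  -- All neighbours of an apex lie on the rim, so two distinct ones are `prev u` and `next u`.
  apex-neighbours : {u v w : V} → kind u ≡ apex → u ~ v → u ~ w → v ≢ w →
                    Opposite (kind v) (kind w)
  apex-neighbours {u = u} a uv uw v≢w
    with thin⇒neighbour (apex-thin a uv) | thin⇒neighbour (apex-thin a uw)
  ... | inj₁ refl | inj₁ refl = contradiction refl v≢w
  ... | inj₁ refl | inj₂ refl = opposite-sym (apex-ends u a)
  ... | inj₂ refl | inj₁ refl = apex-ends u a
  ... | inj₂ refl | inj₂ refl = contradiction refl v≢w

  -- A core `u` would lie opposite both `x` and `y`, which are already on opposite sides.
  common-apex : {u x y : V} → Core (kind x) → Core (kind y) → x ~ y →
                u ~ x → u ~ y → kind u ≡ apex
  common-apex {u = u} c d xy ux uy with apex? (kind u)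
  ... | yes a = a
  ... | no  e = contradiction (core-opposite e d uy)
                  (opposite-bipartite (core-opposite e c ux) (core-opposite c d xy))

  next-injective : ∀ {u v} → next u ≡ next v → u ≡ v
  next-injective {u} {v} eq =
    trans (sym (prev-next u)) (trans (cong prev eq) (prev-next v))

  prev-injective : ∀ {u v} → prev u ≡ prev v → u ≡ v
  prev-injective {u} {v} eq =
    trans (sym (next-prev u)) (trans (cong next eq) (next-prev v))

  not-antipodal : ∀ {u v} → next u ≡ prev v → next v ≢ prev u
  not-antipodal {u} {v} a b = next⁴-≢ v
    (trans (cong (next ∘ next ∘ next) b)
    (trans (cong (next ∘ next) (next-prev u))
    (trans (cong next a) (next-prev v))))

  -- Both `u` and `v` have `x` and `y` as their two rim neighbours. In the same order this forces
  -- `u ≡ v`; in swapped order the rim closes up after four steps.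
  no-two-apices : ∀ {u v x y} → Thin u x → Thin u y → Thin v x → Thin v y →
                  u ≢ v → x ≢ y → ⊥
  no-two-apices {u} {v} ux uy vx vy u≢v x≢y
    with thin⇒neighbour ux | thin⇒neighbour uy
       | thin⇒neighbour vx | thin⇒neighbour vy
  ... | inj₁ p | inj₁ q | _      | _      = x≢y (trans p (sym q))
  ... | inj₂ p | inj₂ q | _      | _      = x≢y (trans p (sym q))
  ... | inj₁ p | _      | inj₁ r | _      = u≢v (next-injective (trans (sym p) r))
  ... | inj₂ p | _      | inj₂ r | _      = u≢v (prev-injective (trans (sym p) r))
  ... | _      | inj₁ q | _      | inj₁ s = u≢v (next-injective (trans (sym q) s))
  ... | _      | inj₂ q | _      | inj₂ s = u≢v (prev-injective (trans (sym q) s))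
  ... | inj₁ p | inj₂ q | inj₂ r | inj₁ s =
    not-antipodal (trans (sym p) r) (trans (sym s) q)
  ... | inj₂ p | inj₁ q | inj₁ r | inj₂ s =
    not-antipodal (trans (sym q) s) (trans (sym r) p)

  -- Two consecutive vertices of the path are either both core, or one of them
  -- is an apex whose two neighbours on the path lie on opposite sides.
  P₄-meets-both-sides : (p : Fin 4 → V) →
    p 0F ~ p 1F → p 1F ~ p 2F → p 2F ~ p 3F → p 0F ≢ p 2F → p 1F ≢ p 3F →
    ∃₂ λ i j → Opposite (kind (p i)) (kind (p j))
  P₄-meets-both-sides p p₀p₁ p₁p₂ p₂p₃ p₀≢p₂ p₁≢p₃
    with apex? (kind (p 1F)) | apex? (kind (p 2F))
  ... | yes a | _     = 0F , 2F , apex-neighbours a (~-sym p₀p₁) p₁p₂ p₀≢p₂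
  ... | no  _ | yes b = 1F , 3F , apex-neighbours b (~-sym p₁p₂) p₂p₃ p₁≢p₃
  ... | no  c | no  d = 1F , 2F , core-opposite c d p₁p₂

  P₄-dominates : (p : Fin 4 → V) →
    p 0F ~ p 1F → p 1F ~ p 2F → p 2F ~ p 3F → p 0F ≢ p 2F → p 1F ≢ p 3F →
    ∀ {u} → Core (kind u) → ∃ λ i → Opposite (kind u) (kind (p i))
  P₄-dominates p p₀p₁ p₁p₂ p₂p₃ p₀≢p₂ p₁≢p₃ c
    with P₄-meets-both-sides p p₀p₁ p₁p₂ p₂p₃ p₀≢p₂ p₁≢p₃
  ... | i , j , o = [ i ,_ , j ,_ ]′ (opposite-either c o)

  -- Exclusion of the three forbidden graphs.

  module _ (H : Graph) (e : Embedding H garland) where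

    private
      f = proj₁ e
      f-inj = proj₁ (proj₂ e)
      f-adj = proj₂ (proj₂ e)

    adjacent : ∀ u v {_ : True (adj? H u v)} → f u ~ f v
    adjacent u v {t} = Equivalence.to (f-adj u v) (toWitness t)

    nonadjacent : ∀ u v {_ : False (adj? H u v)} → ¬ f u ~ f v
    nonadjacent u v {t} = toWitnessFalse t ∘ Equivalence.from (f-adj u v)

    distinct : ∀ u v {_ : False (u ≟ v)} → f u ≢ f v
    distinct u v {t} = toWitnessFalse t ∘ f-inj

  -- The only nonadjacent pair of the diamond is `2F`, `3F`. An apex at `0F` or `1F` would make that
  -- pair adjacent, so both are core; then `2F` and `3F` are two apices with the same neighbours.
  diamond-free : ¬ Embedding (complement (2 · P 1 ⊕ P 2)) garland
  diamond-free e@(f , _) = no-two-apices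
    (apex-thin apex₂ (adj 2F 0F)) (apex-thin apex₂ (adj 2F 1F))
    (apex-thin apex₃ (adj 3F 0F)) (apex-thin apex₃ (adj 3F 1F))
    (dist 2F 3F) (dist 0F 1F)
    where
    ◇ : Graph
    ◇ = complement (2 · P 1 ⊕ P 2)
    adj : ∀ u v {_ : True (adj? ◇ u v)} → f u ~ f v
    adj = adjacent ◇ e
    dist : ∀ u v {_ : False (u ≟ v)} → f u ≢ f v
    dist = distinct ◇ e
    core₀ : Core (kind (f 0F))
    core₀ a = nonadjacent ◇ e 2F 3F (inj₂ (apex-neighbours a (adj 0F 2F) (adj 0F 3F) (dist 2F 3F)))
    core₁ : Core (kind (f 1F))
    core₁ a = nonadjacent ◇ e 2F 3F (inj₂ (apex-neighbours a (adj 1F 2F) (adj 1F 3F) (dist 2F 3F)))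
    apex₂ : kind (f 2F) ≡ apex
    apex₂ = common-apex core₀ core₁ (adj 0F 1F) (adj 2F 0F) (adj 2F 1F)
    apex₃ : kind (f 3F) ≡ apex
    apex₃ = common-apex core₀ core₁ (adj 0F 1F) (adj 3F 0F) (adj 3F 1F)

  -- The edge of `P 2` has a core end, which is adjacent to some vertex of the dominating `P 4`.
  P₂+P₄-free : ¬ Embedding (P 2 ⊕ P 4) garland
  P₂+P₄-free e@(f , _) = [ not-core 0F , not-core 1F ]′ (edge-meets-core (adj 0F 1F))
    where
    H : Graph
    H = P 2 ⊕ P 4
    adj : ∀ u v {_ : True (adj? H u v)} → f u ~ f v
    adj = adjacent H e
    apart : (x : Fin 2) (i : Fin 4) → ¬ Adj H (x ↑ˡ 4) (2 ↑ʳ i)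
    apart = from-yes (all? {2} λ x → all? {4} λ i → ¬? (adj? H (x ↑ˡ 4) (2 ↑ʳ i)))
    not-core : (x : Fin 2) → ¬ Core (kind (f (x ↑ˡ 4)))
    not-core x c with P₄-dominates (f ∘ (2 ↑ʳ_)) (adj 2F 3F) (adj 3F 4F) (adj 4F 5F)
                        (distinct H e 2F 4F) (distinct H e 3F 5F) c
    ... | i , o = nonadjacent H e (x ↑ˡ 4) (2 ↑ʳ i) {fromWitnessFalse (apart x i)} (inj₂ o)

  -- The first and the last edge each contain a core vertex. These two vertices
  -- are not adjacent, hence on the same side, and so have a common neighbour
  -- among the first four vertices of the path, which is absurd.
  P₆-free : ¬ Embedding (P 6) garland
  P₆-free e@(f , _) =
    [ (λ c → [ no-core-ends 0F 0F c , no-core-ends 0F 1F c ]′ lastEdge)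
    , (λ c → [ no-core-ends 1F 0F c , no-core-ends 1F 1F c ]′ lastEdge)
    ]′ (edge-meets-core (adj 0F 1F))
    where
    adj : ∀ u v {_ : True (adj? (P 6) u v)} → f u ~ f v
    adj = adjacent (P 6) e
    lastEdge : Core (kind (f 4F)) ⊎ Core (kind (f 5F))
    lastEdge = edge-meets-core (adj 4F 5F)
    far : (x y : Fin 2) → ¬ Adj (P 6) (x ↑ˡ 4) (4 ↑ʳ y)
    far = from-yes (all? {2} λ x → all? {2} λ y → ¬? (adj? (P 6) (x ↑ˡ 4) (4 ↑ʳ y)))
    no-common : (x y : Fin 2) (i : Fin 4) →
      ¬ (Adj (P 6) (x ↑ˡ 4) (i ↑ˡ 2) × Adj (P 6) (4 ↑ʳ y) (i ↑ˡ 2))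
    no-common = from-yes (all? {2} λ x → all? {2} λ y → all? {4} λ i →
      ¬? (adj? (P 6) (x ↑ˡ 4) (i ↑ˡ 2) ×-dec adj? (P 6) (4 ↑ʳ y) (i ↑ˡ 2)))
    reflect : ∀ {u v} → f u ~ f v → Adj (P 6) u v
    reflect {u} {v} = Equivalence.from (proj₂ (proj₂ e) u v)
    no-core-ends : (x y : Fin 2) → Core (kind (f (x ↑ˡ 4))) → Core (kind (f (4 ↑ʳ y))) → ⊥
    no-core-ends x y c d with P₄-dominates (f ∘ (_↑ˡ 2)) (adj 0F 1F) (adj 1F 2F) (adj 2F 3F)
                                (distinct (P 6) e 0F 2F) (distinct (P 6) e 1F 3F) c
    ... | i , o = no-common x y i (reflect (inj₂ o) , reflect (inj₂ o′))
      where
      o′ : Opposite (kind (f (4 ↑ʳ y))) (kind (f (i ↑ˡ 2)))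
      o′ = subst (λ k → Opposite k (kind (f (i ↑ˡ 2))))
             (same-side c d (far x y ∘ reflect ∘ inj₂)) o

-- Embeddings between garlands.

-- Embeddings preserve core vertices (they have three pairwise distinct
-- neighbours that are not pairwise on opposite sides) and apices (their two
-- neighbours are adjacent core vertices), hence also the edges of the rim; as
-- rims are 2-regular, the image is closed under both rim neighbours.
module _ (R S : Rim) where

  private
    module R where
      open Rim R public
      open Garland R public
    module S where
      open Rim S public
      open Garland S public

  module _ (e : Embedding R.garland S.garland) where

    private
      f = proj₁ e
      f-inj = proj₁ (proj₂ e)
      f-adj = proj₂ (proj₂ e)

    f-~ : ∀ {u v} → u R.~ v → f u S.~ f v
    f-~ {u} {v} = Equivalence.to (f-adj u v)

    f-core : ∀ {u} → Core (R.kind u) → Core (S.kind (f u))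
    -- The three neighbours are the two apices beside `u` and the core vertex two steps ahead; an
    -- apex image would make them pairwise opposite, impossible with two sides.
    f-core {u} c a = opposite-bipartite
      (ends (R.~-next u) (R.~-prev u) (R.next≢prev u))
      (ends (R.~-prev u) (inj₂ u-opp) (≢-sym next²≢prev))
      (ends (R.~-next u) (inj₂ u-opp) next≢next²)
      where
      ends : ∀ {v w} → u R.~ v → u R.~ w → v ≢ w → Opposite (S.kind (f v)) (S.kind (f w))
      ends uv uw v≢w = S.apex-neighbours a (f-~ uv) (f-~ uw) (v≢w ∘ f-inj)
      u-opp : Opposite (R.kind u) (R.kind (R.next (R.next u)))
      u-opp = R.core-next² u c
      c² : Core (R.kind (R.next (R.next u)))
      c² = opposite⇒core (opposite-sym u-opp)
      next≢next² : R.next u ≢ R.next (R.next u)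
      next≢next² eq = c² (trans (cong R.kind (sym eq)) (R.core-next c))
      next²≢prev : R.next (R.next u) ≢ R.prev u
      next²≢prev eq = c² (trans (cong R.kind eq) (R.core-prev c))

    f-apex : ∀ {u} → R.kind u ≡ apex → S.kind (f u) ≡ apex
    f-apex {u} a = S.common-apex
      (f-core (opposite⇒core o)) (f-core (opposite⇒core (opposite-sym o)))
      (f-~ (inj₂ o)) (f-~ (R.~-prev u)) (f-~ (R.~-next u))
      where
      o : Opposite (R.kind (R.prev u)) (R.kind (R.next u))
      o = R.apex-ends u a

    f-thin : ∀ {u v} → R.Thin u v → S.Thin (f u) (f v)
    f-thin t with R.thin⇒alternating t
    ... | inj₁ (a , _) = S.apex-thin (f-apex a) (f-~ (inj₁ t))
    ... | inj₂ (_ , a) = swap (S.apex-thin (f-apex a) (f-~ (inj₁ (swap t))))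

    Hit : S.V → Set
    Hit w = ∃ λ u → f u ≡ w

    neighbours-hit : ∀ u → Hit (S.next (f u)) × Hit (S.prev (f u))
    neighbours-hit u with S.thin⇒neighbour (f-thin (inj₁ {B = R.next (R.next u) ≡ u} refl))
                        | S.thin⇒neighbour (f-thin (inj₂ (R.next-prev u)))
    ... | inj₁ p | inj₁ q = contradiction (f-inj (trans p (sym q))) (R.next≢prev u)
    ... | inj₂ p | inj₂ q = contradiction (f-inj (trans p (sym q))) (R.next≢prev u)
    ... | inj₁ p | inj₂ q = (R.next u , p) , (R.prev u , q)
    ... | inj₂ p | inj₁ q = (R.prev u , q) , (R.next u , p)

    -- Closure under both rim neighbours spreads the image over the whole rim. The vertex argument
    -- supplies a first image point, since a `Rim` may have length zero.
    surjective : R.V → ∀ w → Hit w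
    surjective u = S.connected Hit
      (λ { _ (u , refl) → proj₁ (neighbours-hit u) })
      (λ { _ (u , refl) → proj₂ (neighbours-hit u) })
      (u , refl)

    -- Choosing preimages gives an injection in the reverse direction.
    embedding⇒length-≤ : R.V → S.length ≤ R.length
    embedding⇒length-≤ u = injective⇒≤ {f = proj₁ ∘ surjective u} λ {v} {w} eq →
      trans (sym (proj₂ (surjective u v))) (trans (cong f eq) (proj₂ (surjective u w)))

-- Concrete rims of length a multiple of 8.

next prev : Fin (suc k) → Fin (suc k)
next i with view i
... | ‵fromℕ     = zero
... | ‵inject₁ j = suc j
prev zero    = fromℕ _
prev (suc i) = inject₁ i

next-fromℕ : ∀ k → next (fromℕ k) ≡ zero
next-fromℕ k rewrite view-fromℕ k = refl

next-inject₁ : (i : Fin k) → next (inject₁ i) ≡ suc i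
next-inject₁ i rewrite view-inject₁ i = refl

next-prev : (i : Fin (suc k)) → next (prev i) ≡ i
next-prev zero    = next-fromℕ _
next-prev (suc i) = next-inject₁ i

prev-next : (i : Fin (suc k)) → prev (next i) ≡ i
prev-next i with view i
... | ‵fromℕ     = refl
... | ‵inject₁ _ = refl

cyclic-induction : (Q : Fin (suc k) → Set) →
  (∀ i → Q i → Q (next i)) → (∀ i → Q i → Q (prev i)) →
  ∀ {i} → Q i → ∀ j → Q j
cyclic-induction Q Q-next Q-prev {i} Qi = <-weakInduction Q
  -- Walk down from `i` to `zero` by `prev`; the next line climbs by `next` to any `j`.
  (<-weakInduction (λ i → Q i → Q zero) id (λ j to0 → to0 ∘ Q-prev (suc j)) i Qi)
  (λ j → subst Q (next-inject₁ j) ∘ Q-next (inject₁ j))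

-- The sides repeat with period 4; the residues are taken modulo 8 so that
-- four steps along the cycle never return to the starting vertex.
residue : ℕ → Fin 8
residue zero    = zero
residue (suc a) = next (residue a)

residue-*8 : ∀ m → residue (m * 8) ≡ zero
residue-*8 zero    = refl
residue-*8 (suc m) = cong (next ∘ next ∘ next ∘ next ∘ next ∘ next ∘ next ∘ next) (residue-*8 m)

residueKind : Fin 8 → Kind
residueKind 0F = left
residueKind 2F = right
residueKind 4F = left
residueKind 6F = right
residueKind _  = apex

residueKind-alternating : ∀ r → Alternating (residueKind r) (residueKind (next r))
residueKind-alternating 0F = inj₂ ((λ ()) , refl)
residueKind-alternating 1F = inj₁ (refl , λ ())
residueKind-alternating 2F = inj₂ ((λ ()) , refl)
residueKind-alternating 3F = inj₁ (refl , λ ())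
residueKind-alternating 4F = inj₂ ((λ ()) , refl)
residueKind-alternating 5F = inj₁ (refl , λ ())
residueKind-alternating 6F = inj₂ ((λ ()) , refl)
residueKind-alternating 7F = inj₁ (refl , λ ())

residueKind-next² : ∀ r → Core (residueKind r) →
                    Opposite (residueKind r) (residueKind (next (next r)))
residueKind-next² 0F _ = lr
residueKind-next² 1F c = contradiction refl c
residueKind-next² 2F _ = rl
residueKind-next² 3F c = contradiction refl c
residueKind-next² 4F _ = lr
residueKind-next² 5F c = contradiction refl c
residueKind-next² 6F _ = rl
residueKind-next² 7F c = contradiction refl c

module _ (m : ℕ) where

  ρ : Fin (suc m * 8) → Fin 8
  ρ u = residue (toℕ u)

  -- Going through `prev` allows a case split on `u`; the wrap-around at `zero` is where
  -- divisibility of the length by 8 enters.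
  ρ-prev : ∀ u → next (ρ (prev u)) ≡ ρ u
  ρ-prev zero    = trans (cong (next ∘ residue) (toℕ-fromℕ (7 + m * 8))) (residue-*8 (suc m))
  ρ-prev (suc i) = cong (next ∘ residue) (toℕ-inject₁ i)

  ρ-next : ∀ u → ρ (next u) ≡ next (ρ u)
  ρ-next u = trans (sym (ρ-prev (next u))) (cong (next ∘ ρ) (prev-next u))

  ρ-next² : ∀ u → ρ (next (next u)) ≡ next (next (ρ u))
  ρ-next² u = trans (ρ-next (next u)) (cong next (ρ-next u))

  ρ-next⁴ : ∀ u → ρ (next (next (next (next u)))) ≡ next (next (next (next (ρ u))))
  ρ-next⁴ u = trans (ρ-next² (next (next u))) (cong (next ∘ next) (ρ-next² u))

  rim : Rim
  rim = record
    { length      = suc m * 8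
    ; next        = next
    ; prev        = prev
    ; next-prev   = next-prev
    ; prev-next   = prev-next
    ; next⁴-≢     = λ u eq →
        from-yes (all? {8} λ r → ¬? (next (next (next (next r))) ≟ r)) (ρ u)
          (trans (sym (ρ-next⁴ u)) (cong ρ eq))
    ; connected   = cyclic-induction
    ; kind        = residueKind ∘ ρ
    ; alternating = λ u →
        subst (Alternating (residueKind (ρ u)) ∘ residueKind) (sym (ρ-next u))
          (residueKind-alternating (ρ u))
    ; core-next²  = λ u c →
        subst (Opposite (residueKind (ρ u)) ∘ residueKind) (sym (ρ-next² u))
          (residueKind-next² (ρ u) c)
    }

theorem3 : ¬ WellQuasiOrder (inducedSubgraphOrder
    ((complement (2 · P 1 ⊕ P 2) ∷ P 2 ⊕ P 4 ∷ P 6 ∷ []) -free))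
theorem3 wqo =
  let i , j , i<j , Gᵢ⊑Gⱼ = wqo λ m → G m , G-free m in
  -- The later rim is strictly longer, yet the embedding bounds its length by that of the earlier
  -- one; `zero` is the vertex from which surjectivity starts.
  <⇒≱ (*-monoˡ-< 8 (s<s i<j))
    (embedding⇒length-≤ (rim i) (rim j) (⊑⇒embedding (G i) (G j) Gᵢ⊑Gⱼ) zero)
  where
  G : ℕ → Graph
  G m = Garland.garland (rim m)

  G-free : ∀ m → ((complement (2 · P 1 ⊕ P 2) ∷ P 2 ⊕ P 4 ∷ P 6 ∷ []) -free) (G m)
  G-free m =
      Garland.diamond-free (rim m) ∘ ⊑⇒embedding (complement (2 · P 1 ⊕ P 2)) (G m)
    ∷ Garland.P₂+P₄-free (rim m) ∘ ⊑⇒embedding (P 2 ⊕ P 4) (G m)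
    ∷ Garland.P₆-free (rim m) ∘ ⊑⇒embedding (P 6) (G m)
    ∷ []
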